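{- Suppose $(\varepsilon,\beta,\gamma;(12))\in\mathrm{Par}(n)$. If $\beta$ has a cycle of odd length $d$, then $\gamma$ has at least one cycle whose length divides $d$. Here fixed points are regarded as cycles of length $1$.
   Context: A Latin square of order $n$ is an $n\times n$ array with rows, columns and symbols indexed by $[n]$, each symbol occurring once in each row and each column, with triple set $O(L)$. Permutations act on the right; $\varepsilon$ is the identity. A paratopism $(\alpha,\beta,\gamma;(12))$ maps $L$ to $L^\sigma$ with triple set $\{(y\beta,x\alpha,z\gamma):(x,y,z)\in O(L)\}$; it is an autoparatopism of $L$ if $L^\sigma=L$. $\mathrm{Par}(n)$ is the set of paratopisms that are autoparatopisms of at least one Latin square of order $n$. -}

module Defs where

open import Data.Fin.Base using (Fin; toℕ)
open import Data.Fin.Patterns using (0F; 1F; 2F)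
open import Data.Fin.Permutation using (Permutation′; _⟨$⟩ʳ_; transpose)
open import Data.Nat.Base using (ℕ; _>_)
open import Data.Nat.GeneralisedArithmetic using (iterate)
open import Data.Product.Base using (∃-syntax; _×_)
open import Data.Product using (∃!)
open import Function.Definitions using (Injective)
open import Level using (0ℓ)
open import Relation.Binary.PropositionalEquality.Core using (_≡_)
open import Relation.Unary using (Pred; _≐_; _∈_)

record LatinSquare (n : ℕ) : Set where
  field
    entry  : Fin n → Fin n → Fin n
    row    : ∀ x z → ∃! _≡_ (λ y → entry x y ≡ z)
    column : ∀ y z → ∃! _≡_ (λ x → entry x y ≡ z)

-- Coordinates 0F, 1F, 2F are the row, the column and the symbol.
Triple : ℕ → Set
Triple n = Fin 3 → Fin n

O : ∀ {n} → LatinSquare n → Pred (Triple n) 0ℓ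
O L t = LatinSquare.entry L (t 0F) (t 1F) ≡ t 2F

infix 4 ⟨_,_,_⨾_⟩

-- ⟨ α , β , γ ⨾ δ ⟩ is (α,β,γ;δ), with δ a permutation of the three
-- coordinates.
record Paratopism (n : ℕ) : Set where
  constructor ⟨_,_,_⨾_⟩
  field
    α β γ : Permutation′ n
    δ     : Permutation′ 3

  component : Fin 3 → Permutation′ n
  component 0F = α
  component 1F = β
  component 2F = γ

-- The transposition of rows and columns.
[12] : Permutation′ 3
[12] = transpose 0F 1F

-- The set of images under σ of the triples in T. First α, β, γ act on
-- coordinates 1, 2, 3, then coordinate i is moved to position iδ; so for
-- δ = (12) the image of (x,y,z) is (yβ,xα,zγ). Triples are functions, so
-- "t is the image of s" is stated coordinatewise.
image : ∀ {n} → Paratopism n → Pred (Triple n) 0ℓ → Pred (Triple n) 0ℓ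
image σ T t = ∃[ s ] s ∈ T × (∀ i → t (δ ⟨$⟩ʳ i) ≡ component i ⟨$⟩ʳ s i)
  where open Paratopism σ

-- L^σ = L. A Latin square is determined by its triple set, and that of L^σ
-- is image σ (O L).
IsAutoparatopism : ∀ {n} → Paratopism n → LatinSquare n → Set
IsAutoparatopism σ L = image σ (O L) ≐ O L

Par : ∀ n → Pred (Paratopism n) 0ℓ
Par n σ = ∃[ L ] IsAutoparatopism σ L

-- The cycle (x, xπ, …, xπ^(d-1)) of π; a fixed point gives a cycle of
-- length 1.
record Cycle {n : ℕ} (π : Permutation′ n) (d : ℕ) : Set where
  field
    positive : d > 0
    x        : Fin n
    distinct : Injective _≡_ _≡_ (λ (i : Fin d) → iterate (π ⟨$⟩ʳ_) x (toℕ i))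
    closes   : iterate (π ⟨$⟩ʳ_) x d ≡ x

{-# OPTIONS --safe #-}

-- Let (x, y)σ = (yβ, x), so that the symbol of L in cell cσ is the image
-- under γ of the symbol in cell c. Since σ² = (β, β), for d = 2k + 1 we have
-- (x, y)σᵈ = (yβᵏ⁺¹, xβᵏ). If x lies on a d-cycle of β, then σᵈ fixes the cell
-- (x, xβᵏ), so γᵈ fixes its symbol, whose cycle therefore has length
-- dividing d.

module Submission where

open import Defs
open import Data.Fin.Base using (Fin; toℕ)
open import Data.Fin.Patterns using (0F; 1F; 2F)
open import Data.Fin.Permutation using (Permutation′; _⟨$⟩ʳ_) renaming (id to ε)
open import Data.Fin.Properties using (toℕ<n; toℕ-injective; _≟_)
open import Data.Nat.Base using (ℕ; zero; suc; _+_; _*_; _∸_; _/_; _%_; _≤_; _<_; z<s; s<s⁻¹)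
open import Data.Nat.DivMod using (m%n<n; m≡m%n+[m/n]*n)
open import Data.Nat.Divisibility using (_∣_; m%n≡0⇒n∣m)
open import Data.Nat.GeneralisedArithmetic using (iterate)
open import Data.Nat.Induction using (<-rec)
open import Data.Nat.Properties using (+-comm; *-comm; +-identityʳ; m+[n∸m]≡n; m∸n≤m; ≤-<-trans; ≤-total; anyUpTo?)
open import Data.Product.Base using (∃-syntax; _×_; _,_; proj₁)
open import Data.Sum.Base using (inj₁; inj₂)
open import Function.Bundles using (Injection)
open import Function.Definitions using (Injective)
open import Function.Properties.Inverse using (↔⇒↣)
open import Level using (Level)
open import Relation.Binary.PropositionalEquality using (_≡_; refl; sym; trans; cong; subst; module ≡-Reasoning)
open import Relation.Nullary using (¬_; yes; no; contradiction)
open import Relation.Unary using (Pred; Decidable; _∈_)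

open ≡-Reasoning

private
  variable
    a p : Level
    A : Set a

-- Descent on the witness: while the bounded search finds a smaller one, the recursion restarts from
-- it, and once it finds none the current witness is the least.
least : {P : Pred ℕ p} → Decidable P →
        ∀ v → P v → ∃[ m ] (P m × (∀ {k} → k < m → ¬ P k))
least {P = P} P? = <-rec _ search
  where
  Least = ∃[ m ] (P m × (∀ {k} → k < m → ¬ P k))

  search : ∀ v → (∀ {w} → w < v → P w → Least) → P v → Least
  search v rec Pv with anyUpTo? P? v
  ... | yes (w , w<v , Pw) = rec w<v Pw
  ... | no  none           = v , Pv , λ k<v Pk → none (_ , k<v , Pk)

module _ (f : A → A) where

  iterate-+ : ∀ x m {n} → iterate f x (m + n) ≡ iterate f (iterate f x m) n
  iterate-+ x zero    = refl
  iterate-+ x (suc m) = iterate-+ (f x) m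

  -- `iterate` applies its first `f` to the starting point, whereas `fixed-symbol` needs the extra
  -- step outermost.
  iterate-f : ∀ x n → iterate f (f x) n ≡ f (iterate f x n)
  iterate-f x zero    = refl
  iterate-f x (suc n) = iterate-f (f x) n

  iterate-multiple : ∀ {x e} → iterate f x e ≡ x → ∀ q → iterate f x (q * e) ≡ x
  iterate-multiple         closes zero    = refl
  iterate-multiple {x} {e} closes (suc q) = begin
    iterate f x (e + q * e)            ≡⟨ iterate-+ x e ⟩
    iterate f (iterate f x e) (q * e)  ≡⟨ cong (λ y → iterate f y (q * e)) closes ⟩
    iterate f x (q * e)                ≡⟨ iterate-multiple closes q ⟩
    x                                  ∎

  iterate-injective : Injective _≡_ _≡_ f →
                      ∀ n {x y} → iterate f x n ≡ iterate f y n → x ≡ y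
  iterate-injective inj zero    eq = eq
  iterate-injective inj (suc n) eq = inj (iterate-injective inj n eq)

module _ {n} (π : Permutation′ n) (z : Fin n) where

  private
    f : Fin n → Fin n
    f = π ⟨$⟩ʳ_

  module _ {e : ℕ} (minimal : ∀ {m} → m < e → iterate f z m ≡ z → m ≡ 0) where

    -- Cancelling `i` applications of the injective `f` leaves `z` fixed after `j ∸ i` steps, and
    -- `j ∸ i < e`.
    minimal⇒≡ : ∀ {i j} → i ≤ j → j < e → iterate f z i ≡ iterate f z j → i ≡ j
    minimal⇒≡ {i} {j} i≤j j<e eq = begin
      i            ≡⟨ +-identityʳ i ⟨
      i + 0        ≡⟨ cong (i +_) j∸i≡0 ⟨
      i + (j ∸ i)  ≡⟨ m+[n∸m]≡n i≤j ⟩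
      j            ∎
      where
      shifted : iterate f (iterate f z (j ∸ i)) i ≡ iterate f z i
      shifted = begin
        iterate f (iterate f z (j ∸ i)) i  ≡⟨ iterate-+ f z (j ∸ i) ⟨
        iterate f z (j ∸ i + i)            ≡⟨ cong (iterate f z) (+-comm (j ∸ i) i) ⟩
        iterate f z (i + (j ∸ i))          ≡⟨ cong (iterate f z) (m+[n∸m]≡n i≤j) ⟩
        iterate f z j                      ≡⟨ eq ⟨
        iterate f z i                      ∎

      j∸i≡0 : j ∸ i ≡ 0
      j∸i≡0 = minimal (≤-<-trans (m∸n≤m j i) j<e)
                      (iterate-injective f (Injection.injective (↔⇒↣ π)) i shifted)

    minimal⇒distinct : Injective _≡_ _≡_ (λ (i : Fin e) → iterate f z (toℕ i))
    minimal⇒distinct {i} {j} eq with ≤-total (toℕ i) (toℕ j)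
    ... | inj₁ i≤j = toℕ-injective (minimal⇒≡ i≤j (toℕ<n j) eq)
    ... | inj₂ j≤i = toℕ-injective (sym (minimal⇒≡ j≤i (toℕ<n i) (sym eq)))

  -- `e` is the least positive period of `z`. The remainder of `suc d` modulo `e` is again a period
  -- and is below `e`, so it vanishes.
  cycle-through : ∀ d → iterate f z (suc d) ≡ z → ∃[ e ] (Cycle π e × e ∣ suc d)
  -- The search runs over predecessors of periods, which keeps the period found positive; `d` is the
  -- initial witness.
  cycle-through d closes-d with least (λ m → iterate f z (suc m) ≟ z) d closes-d
  ... | e-1 , closes-e , below = e , cycle , m%n≡0⇒n∣m (suc d) e (minimal (m%n<n (suc d) e) closes-r)
    where
    e = suc e-1
    q = suc d / e
    r = suc d % e

    -- Allowing `m` to be zero makes this apply both to differences of exponents and to the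
    -- remainder `r`.
    minimal : ∀ {m} → m < e → iterate f z m ≡ z → m ≡ 0
    minimal {zero}  _   _  = refl
    minimal {suc m} m<e eq = contradiction eq (below (s<s⁻¹ m<e))

    cycle : Cycle π e
    cycle = record
      { positive = z<s
      ; x        = z
      ; distinct = minimal⇒distinct minimal
      ; closes   = closes-e
      }

    closes-r : iterate f z r ≡ z
    closes-r = begin
      iterate f z r                      ≡⟨ cong (λ y → iterate f y r) (iterate-multiple f closes-e q) ⟨
      iterate f (iterate f z (q * e)) r  ≡⟨ iterate-+ f z (q * e) ⟨
      iterate f z (q * e + r)            ≡⟨ cong (iterate f z) (+-comm (q * e) r) ⟩
      iterate f z (r + q * e)            ≡⟨ cong (iterate f z) (m≡m%n+[m/n]*n (suc d) e) ⟨
      iterate f z (suc d)                ≡⟨ closes-d ⟩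
      z                                  ∎

module _ {n} {β γ : Permutation′ n} (L : LatinSquare n)
         (auto : IsAutoparatopism ⟨ ε , β , γ ⨾ [12] ⟩ L) where

  open LatinSquare L using (entry)

  private
    b c : Fin n → Fin n
    b = β ⟨$⟩ʳ_
    c = γ ⟨$⟩ʳ_

    triple : Fin n → Fin n → Fin n → Triple n
    triple x y z 0F = x
    triple x y z 1F = y
    triple x y z 2F = z

  -- The triple of `L` at the cell (x, y) has an image under σ, and autoparatopism puts this image
  -- back into `O L`.
  entry-σ : ∀ x y → entry (b y) x ≡ c (entry x y)
  entry-σ x y = proj₁ auto {triple (b y) x (c (entry x y))}
    (triple x y (entry x y) , refl , λ { 0F → refl ; 1F → refl ; 2F → refl })

  entry-σ² : ∀ x y → entry (b x) (b y) ≡ c (c (entry x y))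
  entry-σ² x y = trans (entry-σ (b y) x) (cong c (entry-σ x y))

  -- Induction on `k`, peeling off the first σ². The exponent is `k * 2` because `suc k * 2` unfolds
  -- to two more steps of `c`.
  entry-σ²ᵏ : ∀ k x y → entry (iterate b x k) (iterate b y k) ≡ iterate c (entry x y) (k * 2)
  entry-σ²ᵏ zero    x y = refl
  entry-σ²ᵏ (suc k) x y =
    trans (entry-σ²ᵏ k (b x) (b y)) (cong (λ z → iterate c z (k * 2)) (entry-σ² x y))

  -- With y = xβᵏ, the power σ²ᵏ takes the cell (x, y) to (y, yβᵏ), and one more σ takes that to
  -- (yβᵏ⁺¹, y). This is (x, y) again, since yβᵏ⁺¹ = xβ²ᵏ⁺¹ = x.
  fixed-symbol : ∀ k x → iterate b x (1 + k * 2) ≡ x →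
                 let z = entry x (iterate b x k) in iterate c z (1 + k * 2) ≡ z
  fixed-symbol k x closes = begin
    iterate c (c z) (k * 2)                    ≡⟨ iterate-f c z (k * 2) ⟩
    c (iterate c z (k * 2))                    ≡⟨ cong c (entry-σ²ᵏ k x y) ⟨
    c (entry (iterate b x k) (iterate b y k))  ≡⟨ entry-σ (iterate b x k) (iterate b y k) ⟨
    entry (b (iterate b y k)) y                ≡⟨ cong (λ w → entry w y) returns ⟩
    z                                          ∎
    where
    y = iterate b x k
    z = entry x y

    returns : b (iterate b y k) ≡ x
    returns = begin
      b (iterate b y k)                ≡⟨ iterate-f b y k ⟨
      iterate b (b y) k                ≡⟨ cong (λ w → iterate b w k) (iterate-f b x k) ⟨
      iterate b (iterate b (b x) k) k  ≡⟨ iterate-+ b (b x) k ⟨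
      iterate b (b x) (k + k)          ≡⟨ cong (iterate b (b x)) k+k≡k*2 ⟩
      iterate b x (1 + k * 2)          ≡⟨ closes ⟩
      x                                ∎
      where
      k+k≡k*2 : k + k ≡ k * 2
      k+k≡k*2 = trans (cong (k +_) (sym (+-identityʳ k))) (*-comm 2 k)

theorem4p3 : ∀ (n : ℕ) (β γ : Permutation′ n) → ⟨ ε , β , γ ⨾ [12] ⟩ ∈ Par n →
    ∀ (d : ℕ) → d % 2 ≡ 1 → Cycle β d → ∃[ e ] (Cycle γ e × e ∣ d)
theorem4p3 n β γ (L , auto) d odd cyc =
  subst (λ m → ∃[ e ] (Cycle γ e × e ∣ m)) (sym d≡1+k*2)
    (cycle-through γ _ (k * 2) (fixed-symbol L auto k x closes′))
  where
  open Cycle cyc using (x; closes)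

  k = d / 2

  -- Division by 2 with remainder 1 yields exactly the shape `1 + k * 2` that `fixed-symbol`
  -- expects.
  d≡1+k*2 : d ≡ 1 + k * 2
  d≡1+k*2 = trans (m≡m%n+[m/n]*n d 2) (cong (_+ k * 2) odd)

  closes′ : iterate (β ⟨$⟩ʳ_) x (1 + k * 2) ≡ x
  closes′ = subst (λ m → iterate (β ⟨$⟩ʳ_) x m ≡ x) d≡1+k*2 closes
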